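{- Bipartite graphs are ideally $[3,4]$-choosable, and $[3,4]$-LISTCOL can be solved in $O(|V|)$ in the class of bipartite graphs.
   Context: All graphs are finite and simple. For a graph $G=(V,E)$ and an assignment of lists $L(v)$ of colors to the vertices, a list coloring is a proper vertex coloring $c$ of $G$ with $c(v)\in L(v)$ for all $v\in V$. For integers $k\ge\ell$, a graph $G=(V,E)$ is ideally $[\ell,k]$-choosable if for every assignment of lists $L(v)\subseteq\{1,\dots,k\}$ with $|L(v)|=\ell$ for all $v\in V$, every vertex $v_0$ and every color $c_0\in L(v_0)$, there is a list coloring $c$ of $G$ with $c(v_0)=c_0$. $[\ell,k]$-LISTCOL is the following decision problem: given a graph $G=(V,E)$ and lists $L(v)\subseteq\{1,\dots,k\}$ with $|L(v)|=\ell$ for all $v\in V$, decide whether there is a list coloring. -}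

module Defs where

open import Data.Bool.Base using (Bool; true; false; T; if_then_else_)
open import Data.Fin.Base using (Fin; toℕ)
open import Data.Fin.Subset using (Subset; _∈_; ∣_∣)
open import Data.List.Base using (List; _∷_; _++_; map; concatMap; head; drop; length; allFin; filterᵇ)
open import Data.List.Scans.Base using (scanl)
open import Data.Maybe.Base using (Maybe; just; nothing; fromMaybe)
open import Data.Nat.Base using (ℕ; zero; suc; _+_; _*_; _∸_; _≤_; _≡ᵇ_)
open import Data.Product.Base using (Σ; ∃-syntax; _×_)
open import Data.Vec.Base using (toList)
open import Relation.Binary.PropositionalEquality.Core using (_≡_; _≢_)
open import Relation.Nullary.Reflects using (Reflects)

record Graph : Set where
  field
    order  : ℕ
    adj    : Fin order → Fin order → Bool
    irrefl : ∀ v → adj v v ≡ false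
    symm   : ∀ u v → adj u v ≡ adj v u

  Vertex : Set
  Vertex = Fin order

  Adjacent : Vertex → Vertex → Set
  Adjacent u v = T (adj u v)

open Graph public

Bipartite : Graph → Set
Bipartite G = Σ (Vertex G → Bool) λ side → ∀ u v → Adjacent G u v → side u ≢ side v

-- The colours 1, …, k are the elements of Fin k.
IsListColoring : ∀ {k} (G : Graph) → (Vertex G → Subset k) → (Vertex G → Fin k) → Set
IsListColoring G L c =
  (∀ u v → Adjacent G u v → c u ≢ c v) × (∀ v → c v ∈ L v)

IdeallyChoosable : ℕ → ℕ → Graph → Set
IdeallyChoosable ℓ k G =
  (L : Vertex G → Subset k) → (∀ v → ∣ L v ∣ ≡ ℓ) →
  (v₀ : Vertex G) (c₀ : Fin k) → c₀ ∈ L v₀ →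
  ∃[ c ] (IsListColoring G L c × c v₀ ≡ c₀)

-- Instances of [ℓ,k]-LISTCOL.
record Instance (ℓ k : ℕ) : Set where
  field
    graph : Graph
    lists : Vertex graph → Subset k
    size  : ∀ v → ∣ lists v ∣ ≡ ℓ

open Instance public

HasListColoring : ∀ {ℓ k} → Instance ℓ k → Set
HasListColoring I = ∃[ c ] IsListColoring (graph I) (lists I) c

-- Unit-cost random access machine: registers X₀, X₁, … hold natural numbers
-- and are initially 0; the input is a read-only array of natural numbers with
-- random access (cells beyond its end read as 0).
data Instr : Set where
  const  : (i c : ℕ) → Instr      -- Xᵢ ← c
  add    : (i j k : ℕ) → Instr    -- Xᵢ ← Xⱼ + Xₖ
  sub    : (i j k : ℕ) → Instr    -- Xᵢ ← Xⱼ ∸ Xₖ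
  load   : (i j : ℕ) → Instr      -- Xᵢ ← X at address Xⱼ
  store  : (i j : ℕ) → Instr      -- X at address Xᵢ ← Xⱼ
  read   : (i j : ℕ) → Instr      -- Xᵢ ← input cell Xⱼ
  jzero  : (i l : ℕ) → Instr      -- if Xᵢ = 0, continue at instruction l
  accept : Instr
  reject : Instr

Program : Set
Program = List Instr

Registers : Set
Registers = ℕ → ℕ

infixl 5 _[_≔_]
_[_≔_] : Registers → ℕ → ℕ → Registers
(X [ i ≔ x ]) j = if i ≡ᵇ j then x else X j

_!_ : ∀ {A : Set} → List A → ℕ → Maybe A
xs ! i = head (drop i xs)

module _ (P : Program) (input : List ℕ) where

  -- The answer given within t steps from program counter pc and registers X;
  -- nothing if the machine has not halted by then. A program counter outside
  -- the program never leads to an answer.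
  runFrom : (t pc : ℕ) → Registers → Maybe Bool
  exec    : Maybe Instr → (t pc : ℕ) → Registers → Maybe Bool

  runFrom zero    pc X = nothing
  runFrom (suc t) pc X = exec (P ! pc) t pc X

  exec nothing            t pc X = nothing
  exec (just (const i c)) t pc X = runFrom t (suc pc) (X [ i ≔ c ])
  exec (just (add i j k)) t pc X = runFrom t (suc pc) (X [ i ≔ X j + X k ])
  exec (just (sub i j k)) t pc X = runFrom t (suc pc) (X [ i ≔ X j ∸ X k ])
  exec (just (load i j))  t pc X = runFrom t (suc pc) (X [ i ≔ X (X j) ])
  exec (just (store i j)) t pc X = runFrom t (suc pc) (X [ X i ≔ X j ])
  exec (just (read i j))  t pc X = runFrom t (suc pc) (X [ i ≔ fromMaybe 0 (input ! X j) ])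
  exec (just (jzero i l)) t pc X = runFrom t (if X i ≡ᵇ 0 then l else suc pc) X
  exec (just accept)      t pc X = just true
  exec (just reject)      t pc X = just false

  run : ℕ → Maybe Bool
  run t = runFrom t 0 (λ _ → 0)

-- Input format: the number n of vertices; for each vertex the k-cell 0/1
-- characteristic vector of its list; then the adjacency lists, as n + 1 offsets
-- followed by the concatenated neighbour lists, the neighbours of v occupying
-- the positions from offset v up to (excluding) offset (v + 1).
encode : ∀ {ℓ k} → Instance ℓ k → List ℕ
encode I = order G ∷ concatMap listCells vertices
                  ++ scanl _+_ 0 (map (λ v → length (neighbours v)) vertices)
                  ++ map toℕ (concatMap neighbours vertices)
  where
  G : Graph
  G = graph I

  vertices : List (Vertex G)
  vertices = allFin (order G)

  listCells : Vertex G → List ℕ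
  listCells v = map (λ b → if b then 1 else 0) (toList (lists I v))

  neighbours : Vertex G → List (Vertex G)
  neighbours v = filterᵇ (adj G v) vertices

_∈O_ : (ℕ → ℕ) → (ℕ → ℕ) → Set
f ∈O g = ∃[ c ] ∃[ n₀ ] (∀ n → n₀ ≤ n → f n ≤ c * g n)

-- Some RAM program answers [ℓ,k]-LISTCOL correctly on every instance whose
-- graph lies in the class 𝒞, within time O(g(|V|)).
LISTCOLSolvableInO : ℕ → ℕ → (ℕ → ℕ) → (Graph → Set) → Set
LISTCOLSolvableInO ℓ k g 𝒞 =
  Σ Program λ P → Σ (ℕ → ℕ) λ time → (time ∈O g) ×
    ((I : Instance ℓ k) → 𝒞 (graph I) →
      Σ Bool λ answer →
        (run P (encode I) (time (order (graph I))) ≡ just answer) ×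
        Reflects (HasListColoring I) answer)

{-# OPTIONS --safe #-}

-- Split the four colours into two pairs, one for each side of the bipartition.
-- A list of three colours misses only one colour, so it meets both pairs;
-- taking the pair containing c₀ for the side of v₀ allows v₀ to receive c₀.
-- Hence every instance is solvable, and [3,4]-LISTCOL is decided by the program
-- that accepts at once.
module Submission where

open import Defs
open import Data.Product.Base using (_×_)
open import Data.Bool.Base using (Bool; true; false; _xor_)
open import Data.Bool.Properties using (xor-same)
open import Data.Fin.Base using (Fin)
open import Data.Fin.Patterns using (0F; 1F; 2F; 3F)
open import Data.Fin.Properties using (_≟_)
open import Data.Fin.Subset using (Subset; _∈_; _∉_; ∣_∣)
open import Data.Fin.Subset.Properties using (_∈?_; ∣∁p∣≡n∸∣p∣; x∉p⇒x∈∁p; x∈p⇒∣p-x∣<∣p∣; x∈p∧x≢y⇒x∈p-y)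
open import Data.List.Base using (_∷_; [])
open import Data.Nat.Base using (_∸_; _≤_; s≤s⁻¹)
open import Data.Nat.Properties using (≤-reflexive; ≤-trans; <-≤-trans; *-identityˡ; n≮0)
open import Data.Product.Base using (_,_; proj₁; proj₂)
open import Relation.Binary.PropositionalEquality using (_≡_; _≢_; refl; sym; trans; cong; module ≡-Reasoning)
open import Relation.Nullary.Decidable using (yes; no; decidable-stable)
open import Relation.Nullary.Negation using (contradiction)
open import Relation.Nullary.Reflects using (ofʸ)

x∈p∧y∈p∧∣p∣≤1⇒x≡y : ∀ {n} {p : Subset n} {x y} → x ∈ p → y ∈ p → ∣ p ∣ ≤ 1 → x ≡ y
x∈p∧y∈p∧∣p∣≤1⇒x≡y {p = p} {x} {y} x∈p y∈p ∣p∣≤1 = decidable-stable (x ≟ y) λ x≢y →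
  n≮0 (<-≤-trans (x∈p⇒∣p-x∣<∣p∣ (x∈p∧x≢y⇒x∈p-y x∈p x≢y))
                 (s≤s⁻¹ (≤-trans (x∈p⇒∣p-x∣<∣p∣ y∈p) ∣p∣≤1)))

∣p∣≡3∧x∉p∧x≢y⇒y∈p : ∀ {p : Subset 4} {x y} → ∣ p ∣ ≡ 3 → x ∉ p → x ≢ y → y ∈ p
∣p∣≡3∧x∉p∧x≢y⇒y∈p {p} {x} {y} ∣p∣≡3 x∉p x≢y = decidable-stable (y ∈? p) λ y∉p →
  x≢y (x∈p∧y∈p∧∣p∣≤1⇒x≡y (x∉p⇒x∈∁p x∉p) (x∉p⇒x∈∁p y∉p)
    (≤-reflexive (trans (∣∁p∣≡n∸∣p∣ p) (cong (4 ∸_) ∣p∣≡3))))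

pair : Fin 4 → Bool
pair 0F = false
pair 1F = false
pair 2F = true
pair 3F = true

partner : Fin 4 → Fin 4
partner 0F = 1F
partner 1F = 0F
partner 2F = 3F
partner 3F = 2F

a≢partner : ∀ a → a ≢ partner a
a≢partner 0F ()
a≢partner 1F ()
a≢partner 2F ()
a≢partner 3F ()

pair-partner : ∀ a → pair (partner a) ≡ pair a
pair-partner 0F = refl
pair-partner 1F = refl
pair-partner 2F = refl
pair-partner 3F = refl

shift : Bool → Fin 4 → Fin 4
shift false a  = a
shift true  0F = 2F
shift true  1F = 3F
shift true  2F = 0F
shift true  3F = 1F

pair-shift : ∀ s a → pair (shift s a) ≡ s xor pair a
pair-shift false a  = refl
pair-shift true  0F = refl
pair-shift true  1F = refl
pair-shift true  2F = refl
pair-shift true  3F = refl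

xor-cancelʳ : ∀ a {b c} → b xor a ≡ c xor a → b ≡ c
xor-cancelʳ a     {false} {false} _  = refl
xor-cancelʳ a     {true}  {true}  _  = refl
xor-cancelʳ false {false} {true}  ()
xor-cancelʳ true  {false} {true}  ()
xor-cancelʳ false {true}  {false} ()
xor-cancelʳ true  {true}  {false} ()

pick : Subset 4 → Fin 4 → Fin 4
pick p a with a ∈? p
... | yes _ = a
... | no  _ = partner a

pick-∈ : ∀ {p} → ∣ p ∣ ≡ 3 → ∀ a → pick p a ∈ p
pick-∈ {p} ∣p∣≡3 a with a ∈? p
... | yes a∈p = a∈p
... | no  a∉p = ∣p∣≡3∧x∉p∧x≢y⇒y∈p ∣p∣≡3 a∉p (a≢partner a)

pick-self : ∀ {p a} → a ∈ p → pick p a ≡ a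
pick-self {p} {a} a∈p with a ∈? p
... | yes _   = refl
... | no  a∉p = contradiction a∈p a∉p

pair-pick : ∀ p a → pair (pick p a) ≡ pair a
pair-pick p a with a ∈? p
... | yes _ = refl
... | no  _ = pair-partner a

module _ (G : Graph) (bip : Bipartite G) (L : Vertex G → Subset 4) (∣L∣≡3 : ∀ v → ∣ L v ∣ ≡ 3) where

  private
    side : Vertex G → Bool
    side = proj₁ bip

  pairColoring : Bool → Fin 4 → Vertex G → Fin 4
  pairColoring b a v = pick (L v) (shift (side v xor b) a)

  pair-pairColoring : ∀ b a v → pair (pairColoring b a v) ≡ (side v xor b) xor pair a
  pair-pairColoring b a v =
    trans (pair-pick (L v) (shift (side v xor b) a)) (pair-shift (side v xor b) a)

  pairColoring-isListColoring : ∀ b a → IsListColoring G L (pairColoring b a)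
  pairColoring-isListColoring b a = proper , λ v → pick-∈ (∣L∣≡3 v) (shift (side v xor b) a)
    where
    open ≡-Reasoning

    proper : ∀ u v → Adjacent G u v → pairColoring b a u ≢ pairColoring b a v
    proper u v uv cu≡cv = proj₂ bip u v uv (xor-cancelʳ b (xor-cancelʳ (pair a) (begin
      (side u xor b) xor pair a   ≡⟨ pair-pairColoring b a u ⟨
      pair (pairColoring b a u)   ≡⟨ cong pair cu≡cv ⟩
      pair (pairColoring b a v)   ≡⟨ pair-pairColoring b a v ⟩
      (side v xor b) xor pair a   ∎)))

  pairColoring-at : ∀ v {a} → a ∈ L v → pairColoring (side v) a v ≡ a
  pairColoring-at v {a} a∈Lv =
    trans (cong (λ s → pick (L v) (shift s a)) (xor-same (side v))) (pick-self a∈Lv)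

bipartite⇒ideally[3,4]-choosable : (G : Graph) → Bipartite G → IdeallyChoosable 3 4 G
bipartite⇒ideally[3,4]-choosable G bip L ∣L∣≡3 v₀ c₀ c₀∈L =
  pairColoring G bip L ∣L∣≡3 (proj₁ bip v₀) c₀ ,
  pairColoring-isListColoring G bip L ∣L∣≡3 (proj₁ bip v₀) c₀ ,
  pairColoring-at G bip L ∣L∣≡3 v₀ c₀∈L

-- Ideal choosability alone does not give this: the graph may have no vertex v₀.
bipartite⇒hasListColoring : (I : Instance 3 4) → Bipartite (graph I) → HasListColoring I
bipartite⇒hasListColoring I bip =
  pairColoring (graph I) bip (lists I) (size I) false 0F ,
  pairColoring-isListColoring (graph I) bip (lists I) (size I) false 0F

bipartite-[3,4]-LISTCOL-linear : LISTCOLSolvableInO 3 4 (λ n → n) Bipartite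
bipartite-[3,4]-LISTCOL-linear =
  accept ∷ [] , (λ _ → 1) ,
  (1 , 1 , λ n 1≤n → ≤-trans 1≤n (≤-reflexive (sym (*-identityˡ n)))) ,
  λ I bip → true , refl , ofʸ (bipartite⇒hasListColoring I bip)

proposition3p2 : ((G : Graph) → Bipartite G → IdeallyChoosable 3 4 G) × LISTCOLSolvableInO 3 4 (λ n → n) Bipartite
proposition3p2 = bipartite⇒ideally[3,4]-choosable , bipartite-[3,4]-LISTCOL-linear
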